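{- Let $A\subseteq\omega$ be an $m$-rigid set. Then the many-one degree $\deg_m(A)$ contains an infinite antichain of $1$-degrees; that is, there is an infinite sequence $(B_i)_{i\in\omega}$ of subsets of $\omega$ such that $B_i\equiv_m A$ for every $i$ and $B_i\not\le_1 B_j$ for all $i\neq j$.
   Context: $\omega=\{0,1,2,\dots\}$. For $A,B\subseteq\omega$: $A\le_m B$ if there is a total computable function $f:\omega\to\omega$ such that for all $x$, $x\in A\iff f(x)\in B$; $A\le_1 B$ if there is such an $f$ which is moreover injective. $A\equiv_m B$ means $A\le_m B$ and $B\le_m A$, and $A\equiv_1 B$ means $A\le_1 B$ and $B\le_1 A$. $\deg_m(A)=\{X\subseteq\omega: X\equiv_m A\}$ and $\deg_1(A)=\{X\subseteq\omega: X\equiv_1 A\}$. A total computable function $k:\omega\to\omega$ is an $m$-autoreduction of $A$ if for all $x$, $x\in A\iff k(x)\in A$. The set $A$ is $m$-rigid if every $m$-autoreduction $k$ of $A$ is eventually the identity, i.e. $k(x)=x$ for all but finitely many $x$. -}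

module Defs where

open import Data.Fin using (Fin)
open import Data.Nat using (ℕ; zero; suc; _≤_; _<_)
open import Data.Product using (_×_; ∃-syntax)
open import Data.Vec using (Vec; []; _∷_; lookup)
open import Data.Vec.Relation.Binary.Pointwise.Inductive using (Pointwise)
open import Function.Bundles using (_⇔_)
open import Function.Definitions using (Injective)
open import Level using (0ℓ)
open import Relation.Binary.PropositionalEquality using (_≡_)
open import Relation.Unary using (Pred; _∈_)

-- Kleene's μ-recursive functions: `Rec n` is the syntax of n-ary partial
-- recursive functions, and `f [ xs ]⇓ y` says that f is defined on xs with
-- value y.  Recursion and minimisation act on the first argument, and the step
-- function of `prec` receives the counter and then the previous value.
data Rec : ℕ → Set where
  zer  : ∀ {n} → Rec n
  succ : Rec 1
  proj : ∀ {n} → Fin n → Rec n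
  comp : ∀ {m n} → Rec m → Vec (Rec n) m → Rec n
  prec : ∀ {n} → Rec n → Rec (suc (suc n)) → Rec (suc n)
  mu   : ∀ {n} → Rec (suc n) → Rec n

infix 4 _[_]⇓_

data _[_]⇓_ : ∀ {n} → Rec n → Vec ℕ n → ℕ → Set where
  ⇓-zer  : ∀ {n} {xs : Vec ℕ n} → zer [ xs ]⇓ 0
  ⇓-succ : ∀ {x} → succ [ x ∷ [] ]⇓ suc x
  ⇓-proj : ∀ {n} {xs : Vec ℕ n} (i : Fin n) → proj i [ xs ]⇓ lookup xs i
  ⇓-comp : ∀ {m n} {f : Rec m} {gs : Vec (Rec n) m} {xs ys z} →
           Pointwise (λ g y → g [ xs ]⇓ y) gs ys →
           f [ ys ]⇓ z →
           comp f gs [ xs ]⇓ z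
  ⇓-prec-zero : ∀ {n} {f : Rec n} {g xs y} →
                f [ xs ]⇓ y →
                prec f g [ zero ∷ xs ]⇓ y
  ⇓-prec-suc  : ∀ {n} {f : Rec n} {g k xs r y} →
                prec f g [ k ∷ xs ]⇓ r →
                g [ k ∷ r ∷ xs ]⇓ y →
                prec f g [ suc k ∷ xs ]⇓ y
  -- Minimisation requires f to be defined and nonzero at every smaller argument.
  ⇓-mu   : ∀ {n} {f : Rec (suc n)} {xs y} →
           (∀ i → i < y → ∃[ v ] f [ i ∷ xs ]⇓ suc v) →
           f [ y ∷ xs ]⇓ 0 →
           mu f [ xs ]⇓ y

Computable : (ℕ → ℕ) → Set
Computable f = ∃[ e ] (∀ x → e [ x ∷ [] ]⇓ f x)

-- Membership is not assumed decidable.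
Subset : Set₁
Subset = Pred ℕ 0ℓ

_reduces_to_ : (ℕ → ℕ) → Subset → Subset → Set
f reduces A to B = ∀ x → x ∈ A ⇔ f x ∈ B

infix 4 _≤ₘ_ _≤₁_ _≡ₘ_

_≤ₘ_ : Subset → Subset → Set
A ≤ₘ B = ∃[ f ] Computable f × f reduces A to B

_≤₁_ : Subset → Subset → Set
A ≤₁ B = ∃[ f ] Computable f × Injective _≡_ _≡_ f × f reduces A to B

_≡ₘ_ : Subset → Subset → Set
A ≡ₘ B = A ≤ₘ B × B ≤ₘ A

MAutoreduction : Subset → (ℕ → ℕ) → Set
MAutoreduction A k = Computable k × k reduces A to A

EventuallyIdentity : (ℕ → ℕ) → Set
EventuallyIdentity k = ∃[ N ] (∀ x → N ≤ x → k x ≡ x)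

MRigid : Subset → Set
MRigid A = ∀ k → MAutoreduction A k → EventuallyIdentity k

{-# OPTIONS --safe #-}
-- For each i let f i = collapse i be the computable surjection under which the fibre
-- of a > 0 is {2a, 2a+1} if the i-th binary digit of a is 1, and {2a} otherwise;
-- all remaining odd numbers go to 0.  Put B i = (f i)⁻¹(A).  If h reduces B i
-- to B j, then for every computable section s of f i the map f j ∘ h ∘ s is an
-- autoreduction of A, so it is eventually the identity.  Two sections exhaust
-- the fibres of f i over a > 0, so for all large a the map h sends (f i)⁻¹(a)
-- into (f j)⁻¹(a).  When i ≠ j there are arbitrarily large a whose i-th digit
-- is 1 and whose j-th digit is 0, and there h is not injective.
module Submission where

open import Defs
open import Data.Fin using (Fin; zero; suc)
open import Data.Nat using (ℕ; zero; suc; _*_; _≤_; _⊔_; s≤s)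
open import Data.Nat.Properties
  using (≤-trans; m≤m*n; m≤n⇒m≤1+n; m⊔n≤o⇒m≤o; m⊔n≤o⇒n≤o; 1+n≢n)
open import Data.Product using (_×_; _,_; Σ-syntax; ∃-syntax)
open import Data.Sum using (_⊎_; inj₁; inj₂)
open import Data.Vec using (Vec; []; _∷_; lookup)
open import Data.Vec.Relation.Binary.Pointwise.Inductive using ([]; _∷_)
open import Function using (_∘_)
open import Function.Bundles using (mk⇔)
open import Function.Construct.Composition using (_⇔-∘_)
open import Function.Construct.Identity using (⇔-id)
open import Relation.Binary.PropositionalEquality
  using (_≡_; _≢_; refl; sym; trans; cong; subst)
open import Relation.Nullary using (¬_; contradiction)

-- Functions on vectors cover both the binary step functions of recursions and unary functions, so
-- composites can be assembled by combinators without writing codes by hand.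
Computableₙ : ∀ {n} → (Vec ℕ n → ℕ) → Set
Computableₙ {n} F = ∃[ e ] (∀ (xs : Vec ℕ n) → e [ xs ]⇓ F xs)

private variable
  n : ℕ
  F G H : Vec ℕ n → ℕ

lookup-computable : (i : Fin n) → Computableₙ (λ xs → lookup xs i)
lookup-computable i = proj i , λ _ → ⇓-proj i

zero-computable : Computableₙ {n} (λ _ → 0)
zero-computable = zer , λ _ → ⇓-zer

∘-computable : ∀ {f} → Computable f → Computableₙ F → Computableₙ (f ∘ F)
∘-computable (e , p) (e′ , p′) =
  comp e (e′ ∷ []) , λ xs → ⇓-comp (p′ xs ∷ []) (p _)

suc-computable : Computableₙ F → Computableₙ (suc ∘ F)
suc-computable = ∘-computable (succ , λ _ → ⇓-succ)

ifZero : ℕ → ℕ → ℕ → ℕ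
ifZero zero    x y = x
ifZero (suc _) x y = y

ifZero-computable : Computableₙ F → Computableₙ G → Computableₙ H →
                    Computableₙ (λ xs → ifZero (F xs) (G xs) (H xs))
ifZero-computable (e₁ , p₁) (e₂ , p₂) (e₃ , p₃) =
  comp cond (e₁ ∷ e₂ ∷ e₃ ∷ []) , λ xs → ⇓-comp (p₁ xs ∷ p₂ xs ∷ p₃ xs ∷ []) (cond⇓ _)
  where
  cond : Rec 3
  -- The step function sees the counter, the previous value, `x` and `y`, so index 3 selects `y`.
  cond = prec (proj zero) (proj (suc (suc (suc zero))))

  cond⇓ : ∀ c {x y} → cond [ c ∷ x ∷ y ∷ [] ]⇓ ifZero c x y
  cond⇓ zero    = ⇓-prec-zero (⇓-proj _)
  cond⇓ (suc c) = ⇓-prec-suc (cond⇓ c) (⇓-proj _)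

toUnary : Computableₙ {1} F → Computable (λ x → F (x ∷ []))
toUnary (e , p) = e , λ x → p (x ∷ [])

primrec-computable : {f : ℕ → ℕ} → Computableₙ G → f 0 ≡ 0 →
                     (∀ k → f (suc k) ≡ G (k ∷ f k ∷ [])) → Computable f
primrec-computable {f = f} (e , p) f-zero f-suc = prec zer e , f⇓
  where
  f⇓ : ∀ k → prec zer e [ k ∷ [] ]⇓ f k
  f⇓ zero    = subst (prec zer e [ 0 ∷ [] ]⇓_) (sym f-zero) (⇓-prec-zero ⇓-zer)
  f⇓ (suc k) = subst (prec zer e [ suc k ∷ [] ]⇓_) (sym (f-suc k)) (⇓-prec-suc (f⇓ k) (p _))

parity : ℕ → ℕ
parity zero    = 0
parity (suc n) = ifZero (parity n) 1 0

-- Recursion by single steps with a parity test, rather than by two steps at a time, fits the scheme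
-- of `primrec-computable`, whose equations then hold by `refl`.
half : ℕ → ℕ
half zero    = 0
half (suc n) = ifZero (parity n) (half n) (suc (half n))

bit : ℕ → ℕ → ℕ
bit zero    = parity
bit (suc i) = bit i ∘ half

double-computable : Computable (_* 2)
double-computable = primrec-computable
  (suc-computable (suc-computable (lookup-computable (suc zero)))) refl (λ _ → refl)

parity-computable : Computable parity
parity-computable = primrec-computable
  (ifZero-computable (lookup-computable (suc zero)) (suc-computable zero-computable)
     zero-computable)
  refl (λ _ → refl)

half-computable : Computable half
half-computable = primrec-computable
  (ifZero-computable (∘-computable parity-computable (lookup-computable zero))
     (lookup-computable (suc zero)) (suc-computable (lookup-computable (suc zero))))
  refl (λ _ → refl)

∘-computable₁ : ∀ {f g} → Computable f → Computable g → Computable (f ∘ g)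
∘-computable₁ (e , p) (e′ , p′) = comp e (e′ ∷ []) , λ x → ⇓-comp (p′ x ∷ []) (p _)

bit-computable : ∀ i → Computable (bit i)
bit-computable zero    = parity-computable
bit-computable (suc i) = ∘-computable₁ (bit-computable i) half-computable

parity-even : ∀ n → parity (n * 2) ≡ 0
parity-even zero    = refl
parity-even (suc n) rewrite parity-even n = refl

parity-odd : ∀ n → parity (suc (n * 2)) ≡ 1
parity-odd n rewrite parity-even n = refl

half-even : ∀ n → half (n * 2) ≡ n
half-even zero    = refl
half-even (suc n) rewrite parity-even n = cong suc (half-even n)

half-odd : ∀ n → half (suc (n * 2)) ≡ n
half-odd n rewrite parity-even n = half-even n

even⊎odd : ∀ y → ∃[ b ] (y ≡ b * 2 ⊎ y ≡ suc (b * 2))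
even⊎odd zero = 0 , inj₁ refl
even⊎odd (suc y) with even⊎odd y
... | b , inj₁ refl = b , inj₂ refl
... | b , inj₂ refl = suc b , inj₁ refl

bit-zero-cofinal : ∀ j N → ∃[ a ] N ≤ a × bit j a ≡ 0
bit-zero-cofinal zero    N = N * 2 , m≤m*n N 2 , parity-even N
bit-zero-cofinal (suc j) N with bit-zero-cofinal j N
... | b , N≤b , bit≡0 =
  b * 2 , ≤-trans N≤b (m≤m*n b 2) , trans (cong (bit j) (half-even b)) bit≡0

bit-one-cofinal : ∀ i N → ∃[ a ] N ≤ a × bit i a ≡ 1
bit-one-cofinal zero    N = suc (N * 2) , m≤n⇒m≤1+n (m≤m*n N 2) , parity-odd N
bit-one-cofinal (suc i) N with bit-one-cofinal i N
... | b , N≤b , bit≡1 =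
  b * 2 , ≤-trans N≤b (m≤m*n b 2) , trans (cong (bit i) (half-even b)) bit≡1

-- Passing from `b` to `b * 2` or `suc (b * 2)` shifts the digits up one place and inserts a lowest
-- digit of choice. Once one index is 0, that choice settles it, and a cofinality lemma settles the
-- other.
bits-independent : ∀ i j → i ≢ j → ∀ N → ∃[ a ] N ≤ a × bit i a ≡ 1 × bit j a ≡ 0
bits-independent zero    zero    i≢j N = contradiction refl i≢j
bits-independent zero    (suc j) _   N with bit-zero-cofinal j N
... | b , N≤b , bit≡0 =
  suc (b * 2) , m≤n⇒m≤1+n (≤-trans N≤b (m≤m*n b 2)) ,
  parity-odd b , trans (cong (bit j) (half-odd b)) bit≡0
bits-independent (suc i) zero    _   N with bit-one-cofinal i N
... | b , N≤b , bit≡1 =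
  b * 2 , ≤-trans N≤b (m≤m*n b 2) ,
  trans (cong (bit i) (half-even b)) bit≡1 , parity-even b
bits-independent (suc i) (suc j) i≢j N with bits-independent i j (i≢j ∘ cong suc) N
... | b , N≤b , bit≡1 , bit≡0 =
  b * 2 , ≤-trans N≤b (m≤m*n b 2) ,
  trans (cong (bit i) (half-even b)) bit≡1 , trans (cong (bit j) (half-even b)) bit≡0

collapse : ℕ → ℕ → ℕ
collapse i y = ifZero (parity y) (half y) (ifZero (bit i (half y)) 0 (half y))

collapse-computable : ∀ i → Computable (collapse i)
collapse-computable i = toUnary
  (ifZero-computable (∘-computable parity-computable id′) half′
    (ifZero-computable (∘-computable (bit-computable i) half′) zero-computable half′))
  where
  id′   = lookup-computable {1} zero
  half′ = ∘-computable half-computable id′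

collapse-even : ∀ i a → collapse i (a * 2) ≡ a
collapse-even i a rewrite parity-even a = half-even a

collapse-odd : ∀ i a → collapse i (suc (a * 2)) ≡ ifZero (bit i a) 0 a
collapse-odd i a rewrite parity-odd a | half-odd a = refl

-- An odd `y ≡ suc (b * 2)` goes to 0 if digit `j` of `b` is 0, and otherwise to `b`; the value
-- `suc a` would force `b ≡ suc a`, whose digit is 0. Positivity matters, as the fibre over 0
-- collects the leftover odd numbers.
collapse-fibre : ∀ j a y → bit j (suc a) ≡ 0 → collapse j y ≡ suc a → y ≡ suc a * 2
collapse-fibre j a y bit≡0 eq with even⊎odd y
... | b , inj₁ refl = cong (_* 2) (trans (sym (collapse-even j b)) eq)
... | b , inj₂ refl with bit j b in bit-b | trans (sym (collapse-odd j b)) eq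
...   | suc _ | refl with () ← trans (sym bit-b) bit≡0

-- Complements the section `_* 2`: over each positive number with a two-point fibre it picks the odd
-- point.
upperSection : ℕ → ℕ → ℕ
upperSection i a = ifZero (bit i a) (a * 2) (suc (a * 2))

upperSection-computable : ∀ i → Computable (upperSection i)
upperSection-computable i = toUnary
  (ifZero-computable (∘-computable (bit-computable i) (lookup-computable {1} zero))
    double′ (suc-computable double′))
  where
  double′ = ∘-computable double-computable (lookup-computable {1} zero)

collapse-upperSection : ∀ i a → collapse i (upperSection i a) ≡ a
collapse-upperSection i a with bit i a in bit-a
... | zero  = collapse-even i a
... | suc _ = trans (collapse-odd i a) (cong (λ c → ifZero c 0 a) bit-a)

section-reduces : ∀ (A : Subset) {f s : ℕ → ℕ} → (∀ a → f (s a) ≡ a) →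
                  s reduces A to (A ∘ f)
section-reduces A f∘s≗id a =
  mk⇔ (subst A (sym (f∘s≗id a))) (subst A (f∘s≗id a))

preimage-≡ₘ : ∀ (A : Subset) {f s} → Computable f → Computable s → (∀ a → f (s a) ≡ a) →
              (A ∘ f) ≡ₘ A
preimage-≡ₘ A {f} {s} f-comp s-comp f∘s≗id =
  (f , f-comp , λ x → ⇔-id (A (f x))) , (s , s-comp , section-reduces A {f} {s} f∘s≗id)

-- The composite runs from `A` to `A ∘ f` by `s`, on to `A ∘ g` by `h`, and back to `A` by `g`. The
-- last leg holds by definition, so only two equivalences are composed.
rigid-section : ∀ {A : Subset} {f g h s} → MRigid A →
                Computable g → Computable h → Computable s → (∀ a → f (s a) ≡ a) →
                h reduces (A ∘ f) to (A ∘ g) → EventuallyIdentity (g ∘ h ∘ s)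
rigid-section {A} {f} {g} {h} {s} rigid g-comp h-comp s-comp f∘s≗id h-red =
  rigid (g ∘ h ∘ s)
    ( ∘-computable₁ g-comp (∘-computable₁ h-comp s-comp)
    , λ a → h-red (s a) ⇔-∘ section-reduces A {f} {s} f∘s≗id a)

collapse-preimages-≰₁ : ∀ {A : Subset} → MRigid A → ∀ i j → i ≢ j →
                        ¬ ((A ∘ collapse i) ≤₁ (A ∘ collapse j))
collapse-preimages-≰₁ {A} rigid i j i≢j (h , h-comp , h-inj , h-red)
  with rigid-section {A} {collapse i} rigid (collapse-computable j) h-comp
         double-computable (collapse-even i) h-red
     | rigid-section {A} {collapse i} rigid (collapse-computable j) h-comp
         (upperSection-computable i) (collapse-upperSection i) h-red
-- The successor in the bound makes the witness positive, as `collapse-fibre` demands.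
... | N₀ , eventually₀ | N₁ , eventually₁ with bits-independent i j i≢j (suc (N₀ ⊔ N₁))
... | suc a , s≤s N≤a , bit-i , bit-j = contradiction (h-inj h-collision) 1+n≢n
  where
  N≤1+a : N₀ ⊔ N₁ ≤ suc a
  N≤1+a = m≤n⇒m≤1+n N≤a

  upper≡ : upperSection i (suc a) ≡ suc (suc a * 2)
  upper≡ = cong (λ c → ifZero c (suc a * 2) (suc (suc a * 2))) bit-i

  -- Both images under `h` lie in the fibre of `collapse j` over `suc a`, which is a single point
  -- because digit `j` is 0.
  h-lower : h (suc a * 2) ≡ suc a * 2
  h-lower = collapse-fibre j a _ bit-j (eventually₀ (suc a) (m⊔n≤o⇒m≤o N₀ N₁ N≤1+a))

  h-upper : h (upperSection i (suc a)) ≡ suc a * 2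
  h-upper = collapse-fibre j a _ bit-j (eventually₁ (suc a) (m⊔n≤o⇒n≤o N₀ N₁ N≤1+a))

  h-collision : h (suc (suc a * 2)) ≡ h (suc a * 2)
  h-collision = trans (cong h (sym upper≡)) (trans h-upper (sym h-lower))

theorem3p1 : (A : Subset) → MRigid A →
    Σ[ B ∈ (ℕ → Subset) ] ((i : ℕ) → B i ≡ₘ A) × ((i j : ℕ) → i ≢ j → ¬ (B i ≤₁ B j))
theorem3p1 A rigid =
  (λ i → A ∘ collapse i) ,
  (λ i → preimage-≡ₘ A (collapse-computable i) double-computable (collapse-even i)) ,
  collapse-preimages-≰₁ rigid
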